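{- Let $G$ be a connected split graph with at least two vertices. A vertex $v\in V(G)$ is an $\mathcal{F}$-branch leaf of some DFS ordering of $G$ if and only if $v$ is not a cut vertex of $G$.
   Context: Graphs are finite, simple, undirected. A split graph is a graph whose vertex set can be partitioned into a clique and an independent set. A vertex ordering of $G$ is a bijection $\sigma:\{1,\dots,n\}\to V(G)$; $u\prec_\sigma w$ means $u$ comes before $w$. DFS orderings are produced by the label search: initially all labels are $\emptyset$; for $i=1,\dots,n$ choose any unnumbered vertex $x$ such that there is no unnumbered $y$ with $\mathrm{label}(x)\prec\mathrm{label}(y)$, set $\sigma(i)=x$, and add $i$ to the labels of the unnumbered neighbors of $x$, where $A\prec B$ iff ($A=\emptyset$ and $B\neq\emptyset$) or $\max(A)<\max(B)$. The $\mathcal{F}$-tree of $\sigma$ is the spanning tree containing, for each $v\neq\sigma(1)$, the edge from $v$ to its leftmost neighbor in $\sigma$. A vertex $v\neq\sigma(1)$ that is a leaf of the $\mathcal{F}$-tree is an $\mathcal{F}$-branch leaf of $\sigma$. -}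

module Defs where

open import Data.Bool using (if_then_else_)
open import Data.Fin using (Fin; zero; toℕ; fromℕ<; punchIn; _≤_; _<_)
open import Data.Fin.Permutation using (Permutation′; _⟨$⟩ʳ_; _⟨$⟩ˡ_)
open import Data.Fin.Properties using (_≟_; _≤?_; _<?_; all?; toℕ<n)
open import Data.Fin.Subset using (Subset; ⊥; ⁅_⁆; _∪_; ∁; _∈_; Empty; Nonempty)
open import Data.Nat as ℕ using (ℕ; suc)
import Data.Nat.Properties as ℕ
open import Data.Product using (∃-syntax; ∃!; _×_; _,_)
open import Data.Sum using (_⊎_; inj₁; inj₂; swap)
open import Level using (0ℓ)
open import Relation.Binary using (Rel; Symmetric; Irreflexive; Decidable)
open import Relation.Binary.Construct.Closure.ReflexiveTransitive using (Star)
open import Relation.Binary.PropositionalEquality using (_≡_; _≢_; refl)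
open import Relation.Nullary using (¬_; does; ¬?; _×-dec_; _⊎-dec_; _→-dec_)

record Graph (n : ℕ) : Set₁ where
  infix 4 _~_ _~?_
  field
    _~_    : Rel (Fin n) 0ℓ
    sym    : Symmetric _~_
    irrefl : Irreflexive _≡_ _~_
    _~?_   : Decidable _~_

Connected : ∀ {n} → Graph n → Set
Connected G = ∀ u w → Star _~_ u w
  where open Graph G

module _ {n} (G : Graph n) where
  open Graph G

  IsClique : Subset n → Set
  IsClique S = ∀ {u w} → u ∈ S → w ∈ S → u ≢ w → u ~ w

  IsIndependent : Subset n → Set
  IsIndependent S = ∀ {u w} → u ∈ S → w ∈ S → ¬ (u ~ w)

  IsSplit : Set
  IsSplit = ∃[ K ] IsClique K × IsIndependent (∁ K)

  IsLeaf : Fin n → Set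
  IsLeaf v = ∃! _≡_ (v ~_)

-- The vertices other than v are renumbered along punchIn v.
delete : ∀ {n} → Graph (suc n) → Fin (suc n) → Graph n
delete G v = record
  { _~_    = λ x y → punchIn v x ~ punchIn v y
  ; sym    = sym
  ; irrefl = λ { refl → irrefl refl }
  ; _~?_   = λ x y → punchIn v x ~? punchIn v y
  }
  where open Graph G

-- The usual notion when G is connected, the only case in which it is used.
IsCutVertex : ∀ {n} → Graph (suc n) → Fin (suc n) → Set
IsCutVertex G v = ¬ Connected (delete G v)

-- Positions run from 0 to n - 1 instead of from 1 to n.
Ordering : ℕ → Set
Ordering n = Permutation′ n

position : ∀ {n} → Ordering n → Fin n → Fin n
position σ x = σ ⟨$⟩ˡ x

IsMax : ∀ {n} → Subset n → Fin n → Set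
IsMax A a = a ∈ A × (∀ {j} → j ∈ A → j ≤ a)

infix 4 _≺_

_≺_ : ∀ {n} → Rel (Subset n) 0ℓ
A ≺ B = (Empty A × Nonempty B)
      ⊎ (∃[ a ] ∃[ b ] IsMax A a × IsMax B b × a < b)

module _ {n} (G : Graph n) (σ : Ordering n) where
  open Graph G

  -- The label of x once the first k vertices of σ have been numbered.
  label : (k : ℕ) → .(k ℕ.≤ n) → Fin n → Subset n
  label ℕ.zero  _   x = ⊥
  label (suc k) k<n x =
    if does ((i <? position σ x) ×-dec ((σ ⟨$⟩ʳ i) ~? x))
    then label k (ℕ.<⇒≤ k<n) x ∪ ⁅ i ⁆
    else label k (ℕ.<⇒≤ k<n) x
    where
    i : Fin n
    i = fromℕ< k<n

  labelAt : Fin n → Fin n → Subset n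
  labelAt i = label (toℕ i) (ℕ.<⇒≤ (toℕ<n i))

  -- At step i, the unnumbered vertices are those at position i or later.
  IsDFS : Set
  IsDFS = ∀ i → ¬ (∃[ y ] i ≤ position σ y × labelAt i (σ ⟨$⟩ʳ i) ≺ labelAt i y)

  IsLeftmostNeighbor : Fin n → Fin n → Set
  IsLeftmostNeighbor v u = v ~ u × (∀ w → v ~ w → position σ u ≤ position σ w)

  isLeftmostNeighbor? : Decidable IsLeftmostNeighbor
  isLeftmostNeighbor? v u =
    (v ~? u) ×-dec all? (λ w → (v ~? w) →-dec (position σ u ≤? position σ w))

module _ {n} (G : Graph (suc n)) (σ : Ordering (suc n)) where
  open Graph G

  first : Fin (suc n)
  first = σ ⟨$⟩ʳ zero

  -- For an arbitrary ordering this need not be a tree; it is a spanning tree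
  -- when G is connected and σ is a DFS ordering.
  F-tree : Graph (suc n)
  F-tree = record
    { _~_    = λ u w → Chosen u w ⊎ Chosen w u
    ; sym    = swap
    ; irrefl = λ { refl (inj₁ (_ , p , _)) → irrefl refl p
                 ; refl (inj₂ (_ , p , _)) → irrefl refl p }
    ; _~?_   = λ u w → chosen? u w ⊎-dec chosen? w u
    }
    where
    Chosen : Rel (Fin (suc n)) 0ℓ
    Chosen v u = v ≢ first × IsLeftmostNeighbor G σ v u

    chosen? : Decidable Chosen
    chosen? v u = ¬? (v ≟ first) ×-dec isLeftmostNeighbor? G σ v u

  IsF-branchLeaf : Fin (suc n) → Set
  IsF-branchLeaf v = v ≢ first × IsLeaf F-tree v

{-# OPTIONS --safe #-}
module Submission where

-- In a DFS ordering of a connected graph every vertex but the first has an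
-- earlier neighbour, so walking along leftmost neighbours leads to the first
-- vertex; if v is a leaf of the F-tree the walk avoids v, whence G - v is
-- connected.  Conversely, any clique S can be numbered first by a DFS, and then
-- v outside S is a leaf as soon as each neighbour of v lies in S or has a
-- neighbour in S.  For a split graph with clique K take S = {a} with a adjacent
-- to v if v is not in K or K = {v}, and S = K \ {v} otherwise.

open import Data.Bool using (if_then_else_)
open import Data.Fin using (Fin; zero; toℕ; fromℕ<; punchIn; punchOut; _≤_; _<_; _>_)
open import Data.Fin.Induction using (<-wellFounded; >-wellFounded)
open import Data.Fin.Permutation using (_⟨$⟩ʳ_; inverseˡ; inverseʳ; transpose; _∘ₚ_; id)
open import Data.Fin.Properties using
  (_≟_; _≤?_; _<?_; any?; ≤-antisym; ≤∧≢⇒<; <⇒≢; toℕ<n; toℕ-injective; toℕ-fromℕ<; fromℕ<-toℕ;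
   punchInᵢ≢i; punchIn-punchOut; punchOut-injective; punchIn-injective)
open import Data.Fin.Subset using (Subset; ∁; _∈_; _∪_; ⁅_⁆)
open import Data.Fin.Subset.Properties using
  (_∈?_; ∉⊥; nonempty?; x∈⁅x⁆; x∈⁅y⁆⇒x≡y; x∈p∪q⁻; x∈p∪q⁺; x∉p⇒x∈∁p)
open import Data.Nat as ℕ using (ℕ; suc; _+_)
import Data.Nat.Properties as ℕ
open import Data.Product using (∃-syntax; _×_; _,_; proj₁; proj₂)
open import Data.Sum using (_⊎_; inj₁; inj₂)
open import Function using (_∘_; _on_)
open import Function.Bundles using (_⇔_; mk⇔)
open import Induction.WellFounded using (WellFounded; Acc; acc)
open import Relation.Binary using (Rel; Decidable)
import Relation.Binary.Construct.On as On
open import Relation.Binary.Construct.Closure.ReflexiveTransitive using (Star; ε; _◅_; _◅◅_; reverse)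
open import Relation.Binary.PropositionalEquality using (_≡_; _≢_; refl; sym; trans; cong; subst; subst₂)
open import Relation.Nullary using (¬_; Dec; yes; no; does; ¬?; _×-dec_; contradiction)
open import Relation.Nullary.Decidable using (decidable-stable)
import Relation.Unary as U
open import Level using (0ℓ)
open import Defs

-- Extremal elements and transpositions.

minimal : ∀ {m} {_⊏_ : Rel (Fin m) 0ℓ} → WellFounded _⊏_ → Decidable _⊏_ →
          {P : Fin m → Set} → U.Decidable P → ∃[ x ] P x →
          ∃[ x ] P x × (∀ y → P y → ¬ (y ⊏ x))
minimal {_⊏_ = _⊏_} wf _⊏?_ {P} P? (x , px) = descend x px (wf x)
  where
  descend : ∀ x → P x → Acc _⊏_ x → ∃[ x ] P x × (∀ y → P y → ¬ (y ⊏ x))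
  descend x px (acc rs) with any? (λ y → P? y ×-dec (y ⊏? x))
  ... | yes (y , py , y⊏x) = descend y py (rs y⊏x)
  ... | no ∄               = x , px , λ y py y⊏x → ∄ (y , py , y⊏x)

module _ {m} (i p : Fin m) where

  private
    τ : Fin m → Fin m
    τ = transpose i p ⟨$⟩ʳ_

  transpose-left : τ i ≡ p
  transpose-left with i ≟ i
  ... | yes _  = refl
  ... | no i≢i = contradiction refl i≢i

  transpose-fix : ∀ {l} → l ≢ i → l ≢ p → τ l ≡ l
  transpose-fix {l} l≢i l≢p with l ≟ i
  ... | yes l≡i = contradiction l≡i l≢i
  ... | no _ with l ≟ p
  ...   | yes l≡p = contradiction l≡p l≢p
  ...   | no _    = refl

  transpose-fix-< : i ≤ p → ∀ {l} → l < i → τ l ≡ l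
  transpose-fix-< i≤p l<i = transpose-fix (<⇒≢ l<i) (<⇒≢ (ℕ.<-≤-trans l<i i≤p))

  transpose-≥ : i ≤ p → ∀ {l} → i ≤ l → i ≤ τ l
  transpose-≥ i≤p {l} i≤l with l ≟ i
  ... | yes _ = i≤p
  ... | no _ with l ≟ p
  ...   | yes _ = ℕ.≤-refl
  ...   | no _  = i≤l

  -- Only positions from `i` on are swapped, so for `h` up to `i` the set of positions from `h` on
  -- is kept: earlier steps still see the same unnumbered vertices.
  transpose-preserves-≥ : i ≤ p → ∀ {h l : Fin m} → h ≤ i → h ≤ l → h ≤ τ l
  transpose-preserves-≥ i≤p {h} {l} h≤i h≤l with i ≤? l
  ... | yes i≤l = ℕ.≤-trans h≤i (transpose-≥ i≤p i≤l)
  ... | no  i≰l = subst (h ≤_) (sym (transpose-fix-< i≤p (ℕ.≰⇒> i≰l))) h≤l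

-- DFS labels and earlier neighbours.

module _ {m} (G : Graph m) where
  open Graph G using (_~_; _~?_)

  path⇒neighbor : ∀ {u w} → Star _~_ u w → u ≢ w → ∃[ x ] u ~ x
  path⇒neighbor ε         u≢u = contradiction refl u≢u
  path⇒neighbor (u~x ◅ _) _   = _ , u~x

  leftmostNeighbor : Connected G → (σ : Ordering m) → ∀ {v b} → v ≢ b →
                ∃[ u ] IsLeftmostNeighbor G σ v u
  leftmostNeighbor conn σ {v} {b} v≢b =
    let u , v~u , least = minimal (On.wellFounded (position σ) <-wellFounded)
                                  (λ x y → position σ x <? position σ y)
                                  (v ~?_) (path⇒neighbor (conn v b) v≢b)
    in u , v~u , λ w v~w → ℕ.≮⇒≥ (least w v~w)

  module _ (σ : Ordering m) where

    private
      at : Fin m → Fin m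
      at = σ ⟨$⟩ʳ_

    -- The decision is a variable here so that matching on it reduces the `if` from `label`.
    extendLabel⁻ : ∀ {P : Set} (P? : Dec P) {A : Subset m} {i j} →
                   j ∈ (if does P? then A ∪ ⁅ i ⁆ else A) → j ∈ A ⊎ (P × j ≡ i)
    extendLabel⁻ (yes p) {A} {i} j∈ with x∈p∪q⁻ A ⁅ i ⁆ j∈
    ... | inj₁ j∈A = inj₁ j∈A
    ... | inj₂ j∈i = inj₂ (p , x∈⁅y⁆⇒x≡y i j∈i)
    extendLabel⁻ (no _) j∈ = inj₁ j∈

    extendLabel⁺ : ∀ {P : Set} (P? : Dec P) {A : Subset m} {i j} →
                   j ∈ A ⊎ (P × j ≡ i) → j ∈ (if does P? then A ∪ ⁅ i ⁆ else A)
    extendLabel⁺ (yes _) (inj₁ j∈A)        = x∈p∪q⁺ (inj₁ j∈A)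
    extendLabel⁺ (yes _) (inj₂ (_ , refl)) = x∈p∪q⁺ (inj₂ (x∈⁅x⁆ _))
    extendLabel⁺ (no _)  (inj₁ j∈A)        = j∈A
    extendLabel⁺ (no ¬p) (inj₂ (p , _))    = contradiction p ¬p

    extendLabel? : ∀ (i x : Fin m) → Dec (i < position σ x × at i ~ x)
    extendLabel? i x = (i <? position σ x) ×-dec (at i ~? x)

    ∈-label⁻ : ∀ k .(k≤m : k ℕ.≤ m) {x j} → j ∈ label G σ k k≤m x → toℕ j ℕ.< k × at j ~ x
    ∈-label⁻ ℕ.zero  _   j∈ = contradiction j∈ ∉⊥
    ∈-label⁻ (suc k) k<m {x} j∈ with extendLabel⁻ (extendLabel? (fromℕ< k<m) x) j∈
    ... | inj₁ j∈A =
      let j<k , j~x = ∈-label⁻ k (ℕ.<⇒≤ k<m) j∈A in ℕ.m<n⇒m<1+n j<k , j~x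
    ... | inj₂ ((_ , j~x) , refl) = ℕ.s≤s (ℕ.≤-reflexive (toℕ-fromℕ< k<m)) , j~x

    ∈-label⁺ : ∀ k .(k≤m : k ℕ.≤ m) {x j} → toℕ j ℕ.< k → j < position σ x → at j ~ x →
               j ∈ label G σ k k≤m x
    ∈-label⁺ (suc k) k<m {x} {j} j<1+k j<x j~x =
      extendLabel⁺ (extendLabel? (fromℕ< k<m) x) member
      where
      A = label G σ k (ℕ.<⇒≤ k<m) x

      member : j ∈ A ⊎ ((fromℕ< k<m < position σ x × at (fromℕ< k<m) ~ x) × j ≡ fromℕ< k<m)
      member with ℕ.m≤n⇒m<n∨m≡n (ℕ.s≤s⁻¹ j<1+k)
      ... | inj₁ j<k  = inj₁ (∈-label⁺ k (ℕ.<⇒≤ k<m) j<k j<x j~x)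
      ... | inj₂ refl = inj₂ (subst (λ i → i < position σ x × at i ~ x) j≡ (j<x , j~x) , j≡)
        where
        j≡ : j ≡ fromℕ< k<m
        j≡ = sym (fromℕ<-toℕ j k<m)

    -- A label-free form of the choice rule at step i.
    DFSStep : Fin m → Set
    DFSStep i = ∀ {l j} → i ≤ l → j < i → at j ~ at l → ∃[ h ] j ≤ h × h < i × at h ~ at i

    -- Every element of a competing label is bounded by an element of the chosen vertex's label,
    -- which excludes both ways in which the chosen label could be smaller.
    dfsSteps⇒isDFS : (∀ i → DFSStep i) → IsDFS G σ
    dfsSteps⇒isDFS step i (y , i≤y , lt) = go lt
      where
      later : ∀ {b} → b ∈ labelAt G σ i y → ∃[ h ] b ≤ h × h ∈ labelAt G σ i (at i)
      later b∈ =
        let b<i , b~y = ∈-label⁻ (toℕ i) _ b∈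
            h , b≤h , h<i , h~i =
              step i i≤y b<i (subst (at _ ~_) (sym (inverseʳ σ)) b~y)
        in h , b≤h , ∈-label⁺ (toℕ i) _ h<i (subst (h <_) (sym (inverseˡ σ)) h<i) h~i

      go : ¬ (labelAt G σ i (at i) ≺ labelAt G σ i y)
      go (inj₁ (empty , b , b∈)) =
        let h , _ , h∈ = later b∈ in empty (h , h∈)
      go (inj₂ (a , b , (_ , a-max) , (b∈ , _) , a<b)) =
        let h , b≤h , h∈ = later b∈
        in ℕ.<⇒≱ a<b (ℕ.≤-trans b≤h (a-max h∈))

    edge-across : (i : Fin m) → ∀ {u w} → Star _~_ u w → position σ u < i → i ≤ position σ w →
                  ∃[ c ] ∃[ d ] c ~ d × position σ c < i × i ≤ position σ d
    edge-across i ε u<i i≤u = contradiction i≤u (ℕ.<⇒≱ u<i)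
    edge-across i (_◅_ {j = x} u~x path) u<i i≤w with i ≤? position σ x
    ... | yes i≤x = _ , _ , u~x , u<i , i≤x
    ... | no  i≰x = edge-across i path (ℕ.≰⇒> i≰x) i≤w

    -- If the label of the vertex chosen at step `i` were empty, an edge from a numbered `c` to an
    -- unnumbered `d` would give `d` a nonempty label. The path crossing the cut starts at the
    -- numbered vertex `at h`.
    isDFS⇒earlierNeighbor : Connected G → IsDFS G σ → ∀ {h i} → h < i →
                            ∃[ j ] j < i × at j ~ at i
    isDFS⇒earlierNeighbor conn dfs {h} {i} h<i with nonempty? (labelAt G σ i (at i))
    ... | yes (j , j∈) = j , ∈-label⁻ (toℕ i) _ j∈
    ... | no empty = contradiction (d , i≤d , inj₁ (empty , position σ c , c∈)) (dfs i)
      where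
      cut = edge-across i (conn (at h) (at i))
              (subst (_< i) (sym (inverseˡ σ)) h<i)
              (ℕ.≤-reflexive (cong toℕ (sym (inverseˡ σ))))
      c = proj₁ cut
      d = proj₁ (proj₂ cut)
      c~d = proj₁ (proj₂ (proj₂ cut))
      c<i = proj₁ (proj₂ (proj₂ (proj₂ cut)))
      i≤d = proj₂ (proj₂ (proj₂ (proj₂ cut)))

      c∈ : position σ c ∈ labelAt G σ i d
      c∈ = ∈-label⁺ (toℕ i) _ c<i (ℕ.<-≤-trans c<i i≤d) (subst (_~ d) (sym (inverseʳ σ)) c~d)

  -- DFS orderings that number a clique first.

  module _ {S : Fin m → Set} (S? : U.Decidable S)
           (clique : ∀ {u w} → S u → S w → u ≢ w → u ~ w) where

    Step : Ordering m → Fin m → Set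
    Step σ i = DFSStep σ i × (∀ {l} → i ≤ l → S (σ ⟨$⟩ʳ l) → S (σ ⟨$⟩ʳ i))

    module _ (σ : Ordering m) (i : Fin m) (steps : ∀ {j} → j < i → Step σ j) where

      private
        at : Fin m → Fin m
        at = σ ⟨$⟩ʳ_

        at-injective : ∀ {x y} → at x ≡ at y → x ≡ y
        at-injective eq = trans (sym (inverseˡ σ)) (trans (cong (position σ) eq) (inverseˡ σ))

      -- The conditions of `Step` at `i`, read for the vertex currently at `p`, which is to be
      -- swapped into position `i`.
      Candidate : Fin m → Set
      Candidate p = i ≤ p
        × (∀ {l j} → i ≤ l → j < i → at j ~ at l → ∃[ h ] j ≤ h × h < i × at h ~ at p)
        × (∀ {l} → i ≤ l → S (at l) → S (at p))

      -- These are exactly the positions occurring in labels of unnumbered vertices at step `i`.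
      active? : U.Decidable (λ j → j < i × (∃[ l ] i ≤ l × at j ~ at l))
      active? j = (j <? i) ×-dec any? (λ l → (i ≤? l) ×-dec (at j ~? at l))

      -- As long as S is not exhausted only vertices of the clique S have been
      -- numbered, so every remaining vertex of S has the largest possible label.
      candidate : ∃[ p ] Candidate p
      candidate with any? (λ p → (i ≤? p) ×-dec S? (at p))
      ... | yes (p , i≤p , Sp) = p , i≤p , best , λ _ _ → Sp
        where
        best : ∀ {l j} → i ≤ l → j < i → at j ~ at l → ∃[ h ] j ≤ h × h < i × at h ~ at p
        best {j = j} _ j<i _ = j , ℕ.≤-refl , j<i ,
          clique (proj₂ (steps j<i) (ℕ.<⇒≤ j<p) Sp) Sp (<⇒≢ j<p ∘ at-injective)
          where
          j<p = ℕ.<-≤-trans j<i i≤p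
      ... | no ∄S with any? active?
      -- All labels are empty, so the vertex at `i` may stay.
      ...   | no ∄j = i , ℕ.≤-refl ,
        (λ i≤l j<i j~l → contradiction (_ , j<i , _ , i≤l , j~l) ∄j) ,
        (λ i≤l Sl → contradiction (_ , i≤l , Sl) ∄S)
      -- Minimality for `>` yields the largest active `h`; any unnumbered neighbour of it has a
      -- label with the largest maximum.
      ...   | yes ∃j =
        let h , (h<i , p , i≤p , h~p) , greatest =
              minimal >-wellFounded (λ x y → y <? x)
                active? ∃j
        in p , i≤p ,
           (λ {l} {j} i≤l j<i j~l →
              h , ℕ.≮⇒≥ (greatest j (j<i , l , i≤l , j~l)) , h<i , h~p) ,
           (λ i≤l Sl → contradiction (_ , i≤l , Sl) ∄S)

      extend : ∃[ σ′ ] (∀ {j} → j ≤ i → Step σ′ j)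
      extend with candidate
      ... | p , i≤p , best , inS = transpose i p ∘ₚ σ , extended
        where
        σ′ = transpose i p ∘ₚ σ

        fixed : ∀ {j} → j < i → σ′ ⟨$⟩ʳ j ≡ at j
        fixed j<i = cong at (transpose-fix-< i p i≤p j<i)

        old : ∀ {j l} → j ≤ i → j ≤ l → j ≤ (transpose i p ⟨$⟩ʳ l)
        old = transpose-preserves-≥ i p i≤p

        -- Before `i` both orderings agree, so the rule transfers along `q`, the old position of the
        -- vertex now at `j`: it is `j` itself if `j < i`, and `p` if `j` is `i`.
        dfsStep : ∀ {j} → j ≤ i → ∀ q → σ′ ⟨$⟩ʳ j ≡ at q →
          (∀ {l k} → j ≤ l → k < j → at k ~ at l → ∃[ h ] k ≤ h × h < j × at h ~ at q) →
          DFSStep σ′ j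
        dfsStep j≤i q eq rule {l} j≤l k<j k~l =
          let h , k≤h , h<j , h~q =
                rule (old j≤i j≤l) k<j
                  (subst (_~ σ′ ⟨$⟩ʳ l) (fixed (ℕ.<-≤-trans k<j j≤i)) k~l)
          in h , k≤h , h<j ,
             subst₂ _~_ (sym (fixed (ℕ.<-≤-trans h<j j≤i))) (sym eq) h~q

        extended : ∀ {j} → j ≤ i → Step σ′ j
        extended {j} j≤i with ℕ.m≤n⇒m<n∨m≡n j≤i
        ... | inj₁ j<i =
          dfsStep j≤i j (fixed j<i) (proj₁ (steps j<i)) ,
          (λ j≤l Sl → subst S (sym (fixed j<i)) (proj₂ (steps j<i) (old j≤i j≤l) Sl))
        ... | inj₂ j≡i with toℕ-injective j≡i
        ...   | refl =
          dfsStep j≤i p (cong at (transpose-left i p)) best ,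
          (λ j≤l Sl → subst (S ∘ at) (sym (transpose-left i p)) (inS (old j≤i j≤l) Sl))

    partial : ∀ k → ∃[ σ ] (∀ {j} → toℕ j ℕ.< k → Step σ j)
    partial ℕ.zero = id , λ ()
    partial (suc k) with partial k | k ℕ.<? m
    ... | σ , steps | no k≮m = σ , λ {j} _ → steps (ℕ.<-≤-trans (toℕ<n j) (ℕ.≮⇒≥ k≮m))
    ... | σ , steps | yes k<m =
      let σ′ , steps′ = extend σ (fromℕ< k<m)
                          (λ j<k → steps (subst (_ ℕ.<_) (toℕ-fromℕ< k<m) j<k))
      in σ′ , λ j<1+k →
           steps′ (subst (_ ℕ.≤_) (sym (toℕ-fromℕ< k<m)) (ℕ.s≤s⁻¹ j<1+k))

    cliqueFirst-DFS : ∃[ σ ] IsDFS G σ × (∀ {x y} → S x → ¬ S y → position σ x < position σ y)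
    cliqueFirst-DFS =
      let σ , steps = partial m
      in σ , dfsSteps⇒isDFS σ (λ i → proj₁ (steps (toℕ<n i))) ,
         -- If `y` came no later than `x`, then `x` would still be unnumbered at the step of `y`,
         -- forcing `y` into `S`.
         λ Sx ¬Sy → ℕ.≰⇒> λ y≤x → ¬Sy
           (subst S (inverseʳ σ)
             (proj₂ (steps (toℕ<n _)) y≤x (subst S (sym (inverseʳ σ)) Sx)))

-- Leaves of the F-tree.

module _ {n} (G : Graph (suc n)) where
  open Graph G using (_~_; _~?_) renaming (sym to ~-sym; irrefl to ~-irrefl)

  module _ (conn : Connected G) (σ : Ordering (suc n)) where

    private
      pos : Fin (suc n) → Fin (suc n)
      pos = position σ

    pos-injective : ∀ {x y} → pos x ≡ pos y → x ≡ y
    pos-injective eq = trans (sym (inverseʳ σ)) (trans (cong (σ ⟨$⟩ʳ_) eq) (inverseʳ σ))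

    earlier⇒≢first : ∀ {x y} → pos x < pos y → y ≢ first G σ
    earlier⇒≢first {x} x<y refl =
      ℕ.n≮0 (subst (λ i → toℕ (pos x) ℕ.< toℕ i) (inverseˡ σ) x<y)

    0<pos : ∀ {y} → y ≢ first G σ → zero {n} < pos y
    0<pos y≢ = ≤∧≢⇒< ℕ.z≤n λ 0≡ →
      y≢ (pos-injective (trans (sym 0≡) (sym (inverseˡ σ))))

    leftmost-unique : ∀ {v u w} → IsLeftmostNeighbor G σ v u → IsLeftmostNeighbor G σ v w → u ≡ w
    leftmost-unique (v~u , u-min) (v~w , w-min) =
      pos-injective (≤-antisym (u-min _ v~w) (w-min _ v~u))

    -- The last hypothesis prevents `v` from being the leftmost neighbour of any vertex but the
    -- first, so the only tree edge at `v` goes to its own leftmost neighbour.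
    isF-branchLeaf : ∀ {v} → v ≢ first G σ →
      (∀ {w} → v ~ w → w ≢ first G σ → ∃[ u ] w ~ u × pos u < pos v) →
      IsF-branchLeaf G σ v
    isF-branchLeaf {v} v≢f other =
      let u , left = leftmostNeighbor G conn σ v≢f
      in v≢f , u , inj₁ (v≢f , left) , λ where
           (inj₁ (_ , left′)) → leftmost-unique left left′
           (inj₂ (y≢f , y~v , v-min)) →
             let z , y~z , z<v = other (~-sym y~v) y≢f
             in contradiction (v-min z y~z) (ℕ.<⇒≱ z<v)

    earlierLeftmost : IsDFS G σ → ∀ {w} → w ≢ first G σ →
                      ∃[ u ] IsLeftmostNeighbor G σ w u × pos u < pos w
    earlierLeftmost dfs {w} w≢f =
      let u , w~u , u-min = leftmostNeighbor G conn σ w≢f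
          j , j<w , j~w = isDFS⇒earlierNeighbor G σ conn dfs (0<pos w≢f)
          w~j = ~-sym (subst ((σ ⟨$⟩ʳ j) ~_) (inverseʳ σ) j~w)
      in u , (w~u , u-min) ,
         ℕ.≤-<-trans (u-min _ w~j) (subst (_< pos w) (sym (inverseˡ σ)) j<w)

    -- The only tree neighbour of `v` is its own leftmost neighbour, which precedes `v`; a `w`
    -- choosing `v` comes after `v` and would be a second one.
    leaf-notChosen : IsDFS G σ → ∀ {v} → IsF-branchLeaf G σ v →
                     ∀ {w} → w ≢ first G σ → ¬ IsLeftmostNeighbor G σ w v
    leaf-notChosen dfs {v} (v≢f , u , _ , unique) {w} w≢f left
      with earlierLeftmost dfs w≢f | earlierLeftmost dfs v≢f
    ... | v′ , left′ , v′<w | x , leftx , x<v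
      with leftmost-unique left′ left | trans (sym (unique (inj₁ (v≢f , leftx)))) (unique (inj₂ (w≢f , left)))
    ... | refl | refl = ℕ.<-asym v′<w x<v

    leaf⇒delete-connected : IsDFS G σ → ∀ {v} → IsF-branchLeaf G σ v → Connected (delete G v)
    leaf⇒delete-connected dfs {v} leaf x y = toRoot x (wf x) ◅◅ reverse ~-sym (toRoot y (wf y))
      where
      v≢f = proj₁ leaf
      root = punchOut v≢f
      -- Leftmost neighbours come strictly earlier, so the walk to the root terminates by recursion
      -- on positions in `σ`.
      wf = On.wellFounded (pos ∘ punchIn v) <-wellFounded

      toRoot : ∀ x → Acc (_<_ on (pos ∘ punchIn v)) x → Star (Graph._~_ (delete G v)) x root
      toRoot x (acc rs) with punchIn v x ≟ first G σ
      ... | yes eq = subst (λ z → Star _ z root)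
                       (sym (punchIn-injective v _ _ (trans eq (sym (punchIn-punchOut v≢f))))) ε
      ... | no x≢f with earlierLeftmost dfs x≢f
      ...   | u , left@(x~u , _) , u<x =
        subst (punchIn v x ~_) (sym u≡) x~u
          ◅ toRoot (punchOut v≢u) (rs (subst (λ z → pos z < pos (punchIn v x)) (sym u≡) u<x))
        where
        v≢u : v ≢ u
        v≢u refl = leaf-notChosen dfs leaf x≢f left
        u≡ = punchIn-punchOut v≢u

  -- Being nonempty, `S` contains the first vertex `f`. A neighbour of `v` in `S` other than `f` is
  -- adjacent to `f`, and one outside `S` has a neighbour in `S`; all of `S` precedes `v`.
  cliqueFirst-leaf : {S : Fin (suc n) → Set} → U.Decidable S →
    (∀ {u w} → S u → S w → u ≢ w → u ~ w) → Connected G → ∃[ a ] S a →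
    ∀ {v} → ¬ S v → (∀ {w} → v ~ w → S w ⊎ (∃[ u ] S u × w ~ u)) →
    ∃[ σ ] IsDFS G σ × IsF-branchLeaf G σ v
  cliqueFirst-leaf {S} S? clique conn (a , Sa) {v} ¬Sv dominated =
    σ , dfs , isF-branchLeaf conn σ (λ v≡f → ¬Sv (subst S (sym v≡f) Sf)) other
    where
    ordering = cliqueFirst-DFS G S? clique
    σ = proj₁ ordering
    dfs = proj₁ (proj₂ ordering)
    f = first G σ

    S-first : ∀ {x y} → S x → ¬ S y → position σ x < position σ y
    S-first = proj₂ (proj₂ ordering)

    Sf : S f
    Sf = decidable-stable (S? f) λ ¬Sf → earlier⇒≢first conn σ (S-first Sa ¬Sf) refl

    other : ∀ {w} → v ~ w → w ≢ f → ∃[ u ] w ~ u × position σ u < position σ v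
    other v~w w≢f with dominated v~w
    ... | inj₁ Sw             = f , clique Sw Sf w≢f , S-first Sf ¬Sv
    ... | inj₂ (u , Su , w~u) = u , w~u , S-first Su ¬Sv

  -- Non-cut vertices of split graphs.

  noncut-neighbor : ∀ {v} → ¬ IsCutVertex G v → ∀ {w b} → w ≢ v → b ≢ v → w ≢ b →
                    ∃[ z ] z ≢ v × w ~ z
  noncut-neighbor {v} noncut {w} {b} w≢v b≢v w≢b =
    -- `noncut` is a double negation of connectedness; deciding the finite search for `z` removes
    -- it.
    decidable-stable (any? λ z → ¬? (z ≟ v) ×-dec (w ~? z)) λ ∄z → noncut λ conn →
      let z , w~z = path⇒neighbor (delete G v) (conn (punchOut v≢w) (punchOut v≢b)) distinct
      in ∄z (punchIn v z , punchInᵢ≢i v z , subst (_~ punchIn v z) (punchIn-punchOut v≢w) w~z)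
    where
    v≢w = w≢v ∘ sym
    v≢b = b≢v ∘ sym

    distinct : punchOut v≢w ≢ punchOut v≢b
    distinct = w≢b ∘ punchOut-injective v≢w v≢b

  split-noncut-leaf : Connected G → IsSplit G → ∀ {v b} → v ≢ b → ¬ IsCutVertex G v →
                      ∃[ σ ] IsDFS G σ × IsF-branchLeaf G σ v
  split-noncut-leaf conn (K , clique , independent) {v} {b} v≢b noncut
    with path⇒neighbor G (conn v b) v≢b | v ∈? K | any? (λ x → (x ∈? K) ×-dec ¬? (x ≟ v))
  -- Here `v` is on the independent side, so its neighbours all lie in `K` and are equal or adjacent
  -- to `a`.
  ... | a , v~a | no v∉K | _ =
    cliqueFirst-leaf (_≟ a) (λ { refl refl u≢u → contradiction refl u≢u })
      conn (a , refl) (λ { refl → ~-irrefl refl v~a }) dominated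
    where
    dominated : ∀ {w} → v ~ w → w ≡ a ⊎ (∃[ u ] u ≡ a × w ~ u)
    dominated {w} v~w with w ≟ a
    ... | yes w≡a = inj₁ w≡a
    ... | no w≢a  = inj₂ (a , refl , clique (nbr∈K v~w) (nbr∈K v~a) w≢a)
      where
      nbr∈K : ∀ {x} → v ~ x → x ∈ K
      nbr∈K {x} v~x = decidable-stable (x ∈? K) λ x∉K →
        independent (x∉p⇒x∈∁p v∉K) (x∉p⇒x∈∁p x∉K) v~x
  ... | _ | yes v∈K | yes (c , c∈K , c≢v) =
    cliqueFirst-leaf (λ x → (x ∈? K) ×-dec ¬? (x ≟ v))
      (λ (u∈K , _) (w∈K , _) → clique u∈K w∈K)
      conn (c , c∈K , c≢v) (λ (_ , v≢v) → v≢v refl) dominated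
    where
    dominated : ∀ {w} → v ~ w → (w ∈ K × w ≢ v) ⊎ (∃[ u ] (u ∈ K × u ≢ v) × w ~ u)
    dominated {w} v~w with w ∈? K
    ... | yes w∈K = inj₁ (w∈K , λ { refl → ~-irrefl refl v~w })
    ... | no w∉K =
      -- Outside `K`, `w` differs from `c`, so it keeps a neighbour `z` once `v` is deleted;
      -- independence of `∁ K` puts `z` in `K`.
      let z , z≢v , w~z = noncut-neighbor noncut (λ { refl → ~-irrefl refl v~w }) c≢v
                            (λ { refl → w∉K c∈K })
      in inj₂ (z , (decidable-stable (z ∈? K) (λ z∉K →
           independent (x∉p⇒x∈∁p w∉K) (x∉p⇒x∈∁p z∉K) w~z) , z≢v) , w~z)
  -- If K = {v}, then G is a star centred at v, so it has only two vertices.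
  ... | a , v~a | yes v∈K | no K⊆v =
    cliqueFirst-leaf (_≟ a) (λ { refl refl u≢u → contradiction refl u≢u })
      conn (a , refl) (λ { refl → ~-irrefl refl v~a }) (λ v~w → inj₁ (only v~w))
    where
    outside : ∀ {x} → x ≢ v → x ∈ ∁ K
    outside x≢v = x∉p⇒x∈∁p λ x∈K → K⊆v (_ , x∈K , x≢v)

    nbr≢v : ∀ {x} → v ~ x → x ≢ v
    nbr≢v v~x refl = ~-irrefl refl v~x

    only : ∀ {w} → v ~ w → w ≡ a
    only {w} v~w = decidable-stable (w ≟ a) λ w≢a →
      -- A second neighbour `w` of `v` would need a neighbour besides `v`, but both would lie
      -- outside `K`.
      let z , z≢v , w~z = noncut-neighbor noncut (nbr≢v v~w) (nbr≢v v~a) w≢a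
      in independent (outside (nbr≢v v~w)) (outside z≢v) w~z

theorem14 : (n : ℕ) (G : Graph (2 + n)) → Connected G → IsSplit G → (v : Fin (2 + n)) →
    (∃[ σ ] IsDFS G σ × IsF-branchLeaf G σ v) ⇔ (¬ IsCutVertex G v)
theorem14 n G conn split v = mk⇔
  (λ (σ , dfs , leaf) cut → cut (leaf⇒delete-connected G conn σ dfs leaf))
  -- The vertex `b` other than `v` is `punchIn v zero`, available because there are at least two
  -- vertices.
  (split-noncut-leaf G conn split (punchInᵢ≢i v zero ∘ sym))
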